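{- Let $S_1 = (P_r, \sigma_1)$ and $S_2 = (P_s, \sigma_2)$ be signed paths on $r$ and $s$ vertices respectively, and let $S = S_1 \boxtimes S_2$ be their strong product. If $r > 1$ or $s > 1$, then $\chi'(S) = \Delta(S)$.
   Context: All graphs are simple, finite and undirected; $P_r$ is the path on $r$ vertices. A signed graph is a pair $S=(G,\sigma)$ where $G$ is a graph and $\sigma\colon E(G)\to\{+1,-1\}$; $G$ is the underlying graph. $V(S)$, $E(S)$ and $\Delta(S)$ (maximum degree) refer to the underlying graph. An incidence is a pair $v\text{:}e$ of a vertex $v$ and an edge $e$ having $v$ as an endpoint; $I(G)$ is the set of all incidences. For a positive integer $k$ let $M_k=\{0,\pm1,\ldots,\pm l\}$ if $k=2l+1$ and $M_k=\{\pm1,\ldots,\pm l\}$ if $k=2l$. A $k$-edge-coloring of $S=(G,\sigma)$ is a function $f\colon I(G)\to M_k$ such that $f(u\text{:}uv)=-\sigma(uv)f(v\text{:}uv)$ for each edge $uv$, and $f(u\text{:}uv_1)\neq f(u\text{:}uv_2)$ for any two distinct edges $uv_1\neq uv_2$ at a common vertex $u$. The chromatic index $\chi'(S)$ is the smallest $k$ for which $S$ has a $k$-edge-coloring. The strong product $S_1\boxtimes S_2$ of signed graphs $S_1=(G_1,\sigma_1)$, $S_2=(G_2,\sigma_2)$ is the signed graph with vertex set $V(S_1)\times V(S_2)$ in which $(u,u')(v,v')$ is an edge iff one of the following holds: $u=v$ and $u'v'\in E(S_2)$ (sign $\sigma_2(u'v')$); $uv\in E(S_1)$ and $u'=v'$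 (sign $\sigma_1(uv)$); $uv\in E(S_1)$ and $u'v'\in E(S_2)$ (sign $\sigma_1(uv)\sigma_2(u'v')$). -}

module Defs where

open import Axiom.UniquenessOfIdentityProofs using (module Decidable⇒UIP)
open import Data.Fin.Base using (Fin; toℕ)
open import Data.Fin.Properties using (*↔×)
open import Data.Integer.Base using (ℤ; ∣_∣; _◃_; -_) renaming (_*_ to _*ℤ_)
open import Data.List.Base using (List; allFin; filter; length; map)
open import Data.List.Extrema.Nat using (max)
open import Data.Nat.Base using (ℕ; suc; _+_; _*_; _≤_)
open import Data.Nat.Properties using (≡-irrelevant; 1+n≢n; m≢1+n+m)
  renaming (_≟_ to _≟ℕ_)
open import Data.Product.Base using (_×_; _,_; ∃-syntax)
open import Data.Product.Function.NonDependent.Propositional using (_×-↔_)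
open import Data.Sign.Base using (Sign) renaming (_*_ to _*ₛ_)
open import Data.Sum.Base using (_⊎_; inj₁; inj₂; swap)
open import Function.Bundles using (_↔_; Inverse)
open import Function.Properties.Inverse using (↔-refl; ↔-sym; ↔-trans; ↔⇒↣)
open import Relation.Binary.Definitions
  using (Decidable; DecidableEquality; Irrelevant; Symmetric)
open import Relation.Binary.PropositionalEquality
  using (_≡_; _≢_; refl; sym; trans; cong; cong₂)
open import Relation.Nullary using (¬_; contradiction)
open import Relation.Nullary.Decidable using (via-injection; _×-dec_; _⊎-dec_)
import Data.Fin.Properties as Fin

------------------------------------------------------------------------
-- Finite simple graphs

-- Since Adj is proof-irrelevant, the elements of Adj u v carry no data
-- beyond the ordered pair (u , v). An element e : Adj u v thus serves both
-- as the edge uv (identified with adj-sym e) and as the incidence u:uv,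
-- the other incidence v:uv of that edge being adj-sym e.

record Graph : Set₁ where
  field
    Vertex         : Set
    order          : ℕ
    enumeration    : Fin order ↔ Vertex
    Adj            : Vertex → Vertex → Set
    adj?           : Decidable Adj
    adj-irrelevant : Irrelevant Adj
    adj-sym        : Symmetric Adj
    adj-irrefl     : ∀ {u} → ¬ Adj u u

  _≟_ : DecidableEquality Vertex
  _≟_ = via-injection (↔⇒↣ (↔-sym enumeration)) Fin._≟_

  vertices : List Vertex
  vertices = map (Inverse.to enumeration) (allFin order)

  degree : Vertex → ℕ
  degree u = length (filter (adj? u) vertices)

  maxDegree : ℕ
  maxDegree = max 0 (map degree vertices)

record Signature (G : Graph) : Set where
  open Graph G
  field
    sign     : ∀ {u v} → Adj u v → Sign
    sign-sym : ∀ {u v} (e : Adj u v) → sign (adj-sym e) ≡ sign e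

record SignedGraph : Set₁ where
  constructor _,_
  field
    graph     : Graph
    signature : Signature graph

  open Graph graph public
  open Signature signature public

Δ : SignedGraph → ℕ
Δ S = SignedGraph.maxDegree S

------------------------------------------------------------------------
-- Edge colorings

_∈M_ : ℤ → ℕ → Set
z ∈M k = ∃[ l ] ((k ≡ 2 * l + 1 × ∣ z ∣ ≤ l)
               ⊎ (k ≡ 2 * l × 1 ≤ ∣ z ∣ × ∣ z ∣ ≤ l))

record EdgeColoring (S : SignedGraph) (k : ℕ) : Set where
  open SignedGraph S
  field
    color  : ∀ {u v} → Adj u v → ℤ
    range  : ∀ {u v} (e : Adj u v) → color e ∈M k
    signed : ∀ {u v} (e : Adj u v) →
             color e ≡ - (sign e ◃ 1) *ℤ color (adj-sym e)
    proper : ∀ {u v₁ v₂} (e₁ : Adj u v₁) (e₂ : Adj u v₂) →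
             v₁ ≢ v₂ → color e₁ ≢ color e₂

-- χ′(S) = k. Only positive k are considered, so that an edgeless S has
-- chromatic index 1.
IsChromaticIndex : SignedGraph → ℕ → Set
IsChromaticIndex S k =
  1 ≤ k × EdgeColoring S k × (∀ j → 1 ≤ j → EdgeColoring S j → k ≤ j)

------------------------------------------------------------------------
-- Paths

Consecutive : ∀ {r} → Fin r → Fin r → Set
Consecutive i j = (toℕ j ≡ suc (toℕ i)) ⊎ (toℕ i ≡ suc (toℕ j))

consecutive-irrelevant : ∀ {r} → Irrelevant (Consecutive {r})
consecutive-irrelevant (inj₁ p) (inj₁ q) = cong inj₁ (≡-irrelevant p q)
consecutive-irrelevant (inj₂ p) (inj₂ q) = cong inj₂ (≡-irrelevant p q)
consecutive-irrelevant (inj₁ p) (inj₂ q) =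
  contradiction (trans p (cong suc q)) (m≢1+n+m _ {1})
consecutive-irrelevant (inj₂ p) (inj₁ q) =
  contradiction (trans p (cong suc q)) (m≢1+n+m _ {1})

consecutive-irrefl : ∀ {r} {i : Fin r} → ¬ Consecutive i i
consecutive-irrefl (inj₁ p) = 1+n≢n (sym p)
consecutive-irrefl (inj₂ p) = 1+n≢n (sym p)

P : ℕ → Graph
P r = record
  { Vertex         = Fin r
  ; order          = r
  ; enumeration    = ↔-refl
  ; Adj            = Consecutive
  ; adj?           = λ i j → (toℕ j ≟ℕ suc (toℕ i)) ⊎-dec (toℕ i ≟ℕ suc (toℕ j))
  ; adj-irrelevant = consecutive-irrelevant
  ; adj-sym        = swap
  ; adj-irrefl     = consecutive-irrefl
  }

------------------------------------------------------------------------
-- Strong product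

module StrongProduct (S₁ S₂ : SignedGraph) where
  private
    module S₁ = SignedGraph S₁
    module S₂ = SignedGraph S₂

  Vertex⊠ : Set
  Vertex⊠ = S₁.Vertex × S₂.Vertex

  Adj⊠ : Vertex⊠ → Vertex⊠ → Set
  Adj⊠ (u , u′) (v , v′) = (u ≡ v × S₂.Adj u′ v′)
                         ⊎ (S₁.Adj u v × u′ ≡ v′)
                         ⊎ (S₁.Adj u v × S₂.Adj u′ v′)

  sign⊠ : ∀ {x y} → Adj⊠ x y → Sign
  sign⊠ (inj₁ (_ , e′))        = S₂.sign e′
  sign⊠ (inj₂ (inj₁ (e , _)))  = S₁.sign e
  sign⊠ (inj₂ (inj₂ (e , e′))) = S₁.sign e *ₛ S₂.sign e′

  adj⊠-sym : Symmetric Adj⊠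
  adj⊠-sym (inj₁ (p , e′))        = inj₁ (sym p , S₂.adj-sym e′)
  adj⊠-sym (inj₂ (inj₁ (e , p)))  = inj₂ (inj₁ (S₁.adj-sym e , sym p))
  adj⊠-sym (inj₂ (inj₂ (e , e′))) = inj₂ (inj₂ (S₁.adj-sym e , S₂.adj-sym e′))

  sign⊠-sym : ∀ {x y} (e : Adj⊠ x y) → sign⊠ (adj⊠-sym e) ≡ sign⊠ e
  sign⊠-sym (inj₁ (_ , e′))        = S₂.sign-sym e′
  sign⊠-sym (inj₂ (inj₁ (e , _)))  = S₁.sign-sym e
  sign⊠-sym (inj₂ (inj₂ (e , e′))) = cong₂ _*ₛ_ (S₁.sign-sym e) (S₂.sign-sym e′)

  adj⊠? : Decidable Adj⊠
  adj⊠? (u , u′) (v , v′) = (u S₁.≟ v ×-dec S₂.adj? u′ v′)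
                      ⊎-dec ((S₁.adj? u v ×-dec u′ S₂.≟ v′)
                      ⊎-dec (S₁.adj? u v ×-dec S₂.adj? u′ v′))

  adj⊠-irrefl : ∀ {x} → ¬ Adj⊠ x x
  adj⊠-irrefl (inj₁ (_ , e′))       = S₂.adj-irrefl e′
  adj⊠-irrefl (inj₂ (inj₁ (e , _))) = S₁.adj-irrefl e
  adj⊠-irrefl (inj₂ (inj₂ (e , _))) = S₁.adj-irrefl e

  adj⊠-irrelevant : Irrelevant Adj⊠
  adj⊠-irrelevant (inj₁ (p , e′)) (inj₁ (q , f′)) =
    cong inj₁ (cong₂ _,_ (Decidable⇒UIP.≡-irrelevant S₁._≟_ p q)
                         (S₂.adj-irrelevant e′ f′))
  adj⊠-irrelevant (inj₂ (inj₁ (e , p))) (inj₂ (inj₁ (f , q))) =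
    cong inj₂ (cong inj₁ (cong₂ _,_ (S₁.adj-irrelevant e f)
                                    (Decidable⇒UIP.≡-irrelevant S₂._≟_ p q)))
  adj⊠-irrelevant (inj₂ (inj₂ (e , e′))) (inj₂ (inj₂ (f , f′))) =
    cong inj₂ (cong inj₂ (cong₂ _,_ (S₁.adj-irrelevant e f)
                                    (S₂.adj-irrelevant e′ f′)))
  adj⊠-irrelevant (inj₁ (refl , _)) (inj₂ (inj₁ (f , _))) = contradiction f S₁.adj-irrefl
  adj⊠-irrelevant (inj₁ (refl , _)) (inj₂ (inj₂ (f , _))) = contradiction f S₁.adj-irrefl
  adj⊠-irrelevant (inj₂ (inj₁ (e , _))) (inj₁ (refl , _)) = contradiction e S₁.adj-irrefl
  adj⊠-irrelevant (inj₂ (inj₂ (e , _))) (inj₁ (refl , _)) = contradiction e S₁.adj-irrefl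
  adj⊠-irrelevant (inj₂ (inj₁ (_ , refl))) (inj₂ (inj₂ (_ , f′))) = contradiction f′ S₂.adj-irrefl
  adj⊠-irrelevant (inj₂ (inj₂ (_ , e′))) (inj₂ (inj₁ (_ , refl))) = contradiction e′ S₂.adj-irrefl

  graph⊠ : Graph
  graph⊠ = record
    { Vertex         = Vertex⊠
    ; order          = S₁.order * S₂.order
    ; enumeration    = ↔-trans *↔× (S₁.enumeration ×-↔ S₂.enumeration)
    ; Adj            = Adj⊠
    ; adj?           = adj⊠?
    ; adj-irrelevant = adj⊠-irrelevant
    ; adj-sym        = adj⊠-sym
    ; adj-irrefl     = adj⊠-irrefl
    }

infixr 7 _⊠_

_⊠_ : SignedGraph → SignedGraph → SignedGraph
S₁ ⊠ S₂ = graph⊠ , record { sign = λ {x} {y} → sign⊠ {x} {y} ; sign-sym = sign⊠-sym }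
  where open StrongProduct S₁ S₂

{-# OPTIONS --safe #-}

-- A signature on a path is balanced (sign uv = θ u · θ v), hence so is the
-- signature of the product, and switching by θ reduces everything to the
-- all-positive product, where a coloring is an antisymmetric function of
-- ordered pairs of adjacent vertices. Such a coloring can be chosen to depend
-- only on the displacement (a , b) ∈ {-1,0,1}² along an edge: for r, s ≥ 3 the
-- value a + 3b takes each of ±1, …, ±4 once, and shorter paths restrict the
-- displacements enough for a smaller palette. Conversely the colors at a vertex
-- are distinct elements of M_k, and |M_k| = k, so Δ ≤ k for every k-coloring.

module Submission where

open import Defs
open import Data.Fin.Base using (Fin; zero; suc; toℕ; opposite)
open import Data.Fin.Patterns using (0F; 1F; 2F)
open import Data.Fin.Properties as Fin using (all?; toℕ-injective; toℕ≤pred[n])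
open import Data.Integer.Base using (ℤ; +_; -[1+_]; +[1+_]; 0ℤ; -_; _⊖_; _◃_; ∣_∣)
  renaming (_+_ to _+ℤ_; _*_ to _*ℤ_; _-_ to _-ℤ_)
import Data.Integer.Properties as ℤ
open import Data.Integer.Tactic.RingSolver using (solve-∀)
open import Data.List.Base using (List; []; _∷_; _++_; length; map; filter; cartesianProduct)
open import Data.List.Extrema.Nat using (xs≤max; max≤v⁺)
open import Data.List.Membership.Propositional using (_∈_)
open import Data.List.Membership.Propositional.Properties
  using (∈-∃++; ∈-++⁺ˡ; ∈-++⁺ʳ; ∈-++⁻; ∈-map⁺; ∈-filter⁺; ∈-filter⁻; ∈-allFin; ∈-cartesianProduct⁻)
open import Data.List.Properties using (length-++; length-map)
open import Data.List.Relation.Unary.All as All using (All; []; _∷_)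
import Data.List.Relation.Unary.All.Properties as All
open import Data.List.Relation.Unary.AllPairs using ([]; _∷_)
open import Data.List.Relation.Unary.Any using (here; there)
open import Data.List.Relation.Unary.Unique.Propositional using (Unique)
import Data.List.Relation.Unary.Unique.Propositional.Properties as Unique
open import Data.Nat.Base
  using (ℕ; zero; suc; _+_; _*_; _∸_; _⊓_; _⊔_; _≤_; _≥_; _>_; z≤n; s≤s; s≤s⁻¹; ∣_-_∣)
open import Data.Nat.Properties
  using (≤-trans; ≤-antisym; ≤-reflexive; m≤n⇒m<n∨m≡n; *-suc; *-cancelˡ-≡; *-identityˡ; +-comm;
         +-suc; +-identityʳ; suc-injective; even≢odd; _≤?_; ⊓-glb; ⊔-lub; ∣m-n∣≤m⊔n;
         ∣m+n-m+o∣≡∣n-o∣; module ≤-Reasoning)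
open import Data.Product.Base as Product using (_×_; _,_; ∃-syntax; proj₁; proj₂)
open import Data.Sign.Base as Sign using (Sign) renaming (_*_ to _*ₛ_)
import Data.Sign.Properties as Sign
open import Data.Sum.Base using (_⊎_; inj₁; inj₂; swap)
open import Function.Base using (_∘_)
open import Function.Bundles using (Inverse)
open import Relation.Binary.PropositionalEquality
open import Relation.Nullary using (¬_; Dec; contradiction)
open import Relation.Nullary.Decidable
  using (True; toWitness; decidable-stable; _×-dec_; _→-dec_; ¬?)

open import Algebra.Properties.CommutativeSemigroup Sign.*-commutativeSemigroup using (interchange)

-- Pigeonhole principle

-- Induction on `xs`: one occurrence of the head's image is cut out of `ys`, and injectivity keeps
-- the remaining images off it. A relation is used because a color belongs to an adjacency proof,
-- not to a neighbour alone.
length-≤-injective :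
  ∀ {A B : Set} {R : A → B → Set} →
  (∀ {x x′ y} → R x y → R x′ y → x ≡ x′) →
  ∀ {xs} ys → Unique xs → (∀ {x} → x ∈ xs → ∃[ y ] (y ∈ ys × R x y)) →
  length xs ≤ length ys
length-≤-injective inj {[]} ys _ _ = z≤n
length-≤-injective {R = R} inj {x ∷ xs} ys (x∉xs ∷ uxs) image
  with image (here refl)
... | y , y∈ys , Rxy with ∈-∃++ y∈ys
... | as , bs , refl = begin
  suc (length xs)           ≤⟨ s≤s (length-≤-injective inj (as ++ bs) uxs image′) ⟩
  suc (length (as ++ bs))   ≡⟨ cong suc (length-++ as) ⟩
  suc (length as + length bs) ≡⟨ +-suc (length as) _ ⟨
  length as + suc (length bs) ≡⟨ length-++ as ⟨
  length (as ++ y ∷ bs)     ∎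
  where
  open ≤-Reasoning

  image′ : ∀ {x′} → x′ ∈ xs → ∃[ y′ ] (y′ ∈ as ++ bs × R x′ y′)
  image′ x′∈xs with image (there x′∈xs)
  ... | y′ , y′∈ys , Rx′y′ with ∈-++⁻ as y′∈ys
  ... | inj₁ y′∈as         = y′ , ∈-++⁺ˡ y′∈as , Rx′y′
  ... | inj₂ (there y′∈bs) = y′ , ∈-++⁺ʳ as y′∈bs , Rx′y′
  ... | inj₂ (here refl)   = contradiction (inj Rxy Rx′y′) (All.lookup x∉xs x′∈xs)

-- The color set M_k

nonzeroUpTo : ℕ → List ℤ
nonzeroUpTo zero    = []
nonzeroUpTo (suc l) = +[1+ l ] ∷ -[1+ l ] ∷ nonzeroUpTo l

length-nonzeroUpTo : ∀ l → length (nonzeroUpTo l) ≡ 2 * l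
length-nonzeroUpTo zero    = refl
length-nonzeroUpTo (suc l) = begin
  2 + length (nonzeroUpTo l) ≡⟨ cong (λ n → 2 + n) (length-nonzeroUpTo l) ⟩
  2 + 2 * l                  ≡⟨ *-suc 2 l ⟨
  2 * suc l                  ∎
  where open ≡-Reasoning

∈-nonzeroUpTo : ∀ z l → 1 ≤ ∣ z ∣ → ∣ z ∣ ≤ l → z ∈ nonzeroUpTo l
∈-nonzeroUpTo (+ zero) l () _
∈-nonzeroUpTo +[1+ m ] (suc l) 1≤z z≤l with m≤n⇒m<n∨m≡n z≤l
... | inj₁ z<l  = there (there (∈-nonzeroUpTo +[1+ m ] l 1≤z (s≤s⁻¹ z<l)))
... | inj₂ refl = here refl
∈-nonzeroUpTo -[1+ m ] (suc l) 1≤z z≤l with m≤n⇒m<n∨m≡n z≤l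
... | inj₁ z<l  = there (there (∈-nonzeroUpTo -[1+ m ] l 1≤z (s≤s⁻¹ z<l)))
... | inj₂ refl = there (here refl)

-- Any member of M_k reveals the parity of k.
palette : ∀ {z k} → z ∈M k → List ℤ
palette (l , inj₁ _) = 0ℤ ∷ nonzeroUpTo l
palette (l , inj₂ _) = nonzeroUpTo l

length-palette : ∀ {z k} (p : z ∈M k) → length (palette {z} p) ≡ k
length-palette (l , inj₁ (refl , _)) =
  trans (cong suc (length-nonzeroUpTo l)) (+-comm 1 (2 * l))
length-palette (l , inj₂ (refl , _)) = length-nonzeroUpTo l

odd≢even : ∀ l m → 2 * l + 1 ≢ 2 * m
odd≢even l m eq = even≢odd m l (trans (sym eq) (+-comm (2 * l) 1))

-- Parity excludes mixed representations of `k`, and cancellation forces equal `l`, so the list read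
-- off from one member of M_k covers all of it.
∈-palette : ∀ {z k} (p : z ∈M k) w → w ∈M k → w ∈ palette {z} p
∈-palette (l , inj₁ _) (+ zero) (m , inj₁ _) = here refl
∈-palette (l , inj₁ (refl , _)) w@(+[1+ _ ]) (m , inj₁ (eq , w≤m))
  with refl ← *-cancelˡ-≡ l m 2 (suc-injective (trans (+-comm 1 _) (trans eq (+-comm _ 1)))) =
  there (∈-nonzeroUpTo w l (s≤s z≤n) w≤m)
∈-palette (l , inj₁ (refl , _)) w@(-[1+ _ ]) (m , inj₁ (eq , w≤m))
  with refl ← *-cancelˡ-≡ l m 2 (suc-injective (trans (+-comm 1 _) (trans eq (+-comm _ 1)))) =
  there (∈-nonzeroUpTo w l (s≤s z≤n) w≤m)
∈-palette (l , inj₂ (refl , _)) w (m , inj₂ (eq , 1≤w , w≤m))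
  with refl ← *-cancelˡ-≡ l m 2 eq = ∈-nonzeroUpTo w l 1≤w w≤m
∈-palette (l , inj₁ (refl , _)) w (m , inj₂ (eq , _)) = contradiction eq (odd≢even l m)
∈-palette (l , inj₂ (refl , _)) w (m , inj₁ (eq , _)) = contradiction (sym eq) (odd≢even m l)

∈M-resp-∣∣ : ∀ {z w k} → ∣ z ∣ ≡ ∣ w ∣ → w ∈M k → z ∈M k
∈M-resp-∣∣ eq w∈M rewrite eq = w∈M

-- Degrees and the lower bound

module _ (G : Graph) where
  open Graph G

  ∈-vertices : ∀ v → v ∈ vertices
  ∈-vertices v = subst (_∈ vertices) (Inverse.strictlyInverseˡ enumeration v)
    (∈-map⁺ (Inverse.to enumeration) (∈-allFin (Inverse.from enumeration v)))

  vertices-unique : Unique vertices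
  vertices-unique = Unique.map⁺ to-injective (Unique.allFin⁺ order)
    where
    to-injective : ∀ {i j} → Inverse.to enumeration i ≡ Inverse.to enumeration j → i ≡ j
    to-injective {i} {j} eq = trans (sym (Inverse.strictlyInverseʳ enumeration i))
      (trans (cong (Inverse.from enumeration) eq) (Inverse.strictlyInverseʳ enumeration j))

  degree≤maxDegree : ∀ u → degree u ≤ maxDegree
  degree≤maxDegree u = All.lookup (xs≤max 0 (map degree vertices)) (∈-map⁺ degree (∈-vertices u))

  -- The vertex `u` is counted too because closed neighbourhoods, unlike open ones, multiply under
  -- the strong product.
  closedNeighbours≤1+degree : ∀ u {vs} → Unique vs → All (λ v → u ≡ v ⊎ Adj u v) vs →
                              length vs ≤ suc (degree u)
  closedNeighbours≤1+degree u {vs} uvs near =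
    length-≤-injective {R = _≡_} (λ p q → trans p (sym q)) (u ∷ filter (adj? u) vertices) uvs image
    where
    image : ∀ {v} → v ∈ vs → ∃[ w ] (w ∈ u ∷ filter (adj? u) vertices × v ≡ w)
    image {v} v∈vs with All.lookup near v∈vs
    ... | inj₁ refl = v , here refl , refl
    ... | inj₂ e    = v , there (∈-filter⁺ (adj? u) (∈-vertices v) e) , refl

module _ (S : SignedGraph) where
  open SignedGraph S

  degree≤colors : ∀ {k} → EdgeColoring S k → ∀ u → degree u ≤ k
  degree≤colors {k} f u = bound (filter (adj? u) vertices)
    (Unique.filter⁺ (adj? u) (vertices-unique graph))
    (λ v∈ns → proj₂ (∈-filter⁻ (adj? u) {xs = vertices} v∈ns))
    where
    open EdgeColoring f

    Colored : Vertex → ℤ → Set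
    Colored v z = ∃[ e ] color {u} {v} e ≡ z

    colored-injective : ∀ {v v′ z} → Colored v z → Colored v′ z → v ≡ v′
    colored-injective {v} {v′} (e , p) (e′ , q) =
      -- `proper` only refutes equality of colors; decidable equality of vertices turns this into
      -- injectivity.
      decidable-stable (v ≟ v′) λ v≢v′ → proper e e′ v≢v′ (trans p (sym q))

    bound : ∀ ns → Unique ns → (∀ {v} → v ∈ ns → Adj u v) → length ns ≤ k
    bound []       _   _   = z≤n
    -- The color towards the first neighbour is the member of M_k that determines the palette.
    bound (n ∷ ns) uns adj = ≤-trans
      (length-≤-injective {R = Colored} colored-injective (palette {color e} p) uns
        (λ v∈ns → color (adj v∈ns) ,
                  ∈-palette {color e} p (color (adj v∈ns)) (range (adj v∈ns)) , adj v∈ns , refl))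
      (≤-reflexive (length-palette {color e} p))
      where
      e = adj (here refl)
      p = range e

  Δ≤colors : ∀ {k} → EdgeColoring S k → Δ S ≤ k
  Δ≤colors f = max≤v⁺ {xs = map degree vertices} z≤n
    (All.map⁺ (All.tabulate {xs = vertices} (λ {u} _ → degree≤colors f u)))

  -- A single vertex closes the chain `k ≤ degree u ≤ Δ S ≤ k`.
  isChromaticIndex-Δ : ∀ {k} u → 1 ≤ k → k ≤ degree u → EdgeColoring S k →
                       IsChromaticIndex S (Δ S)
  isChromaticIndex-Δ {k} u 1≤k k≤deg f =
    subst (1 ≤_) k≡Δ 1≤k , subst (EdgeColoring S) k≡Δ f , λ _ _ → Δ≤colors
    where
    k≡Δ : k ≡ Δ S
    k≡Δ = ≤-antisym (≤-trans k≤deg (degree≤maxDegree graph u)) (Δ≤colors f)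

-- Switching

Balancing : (S : SignedGraph) → (SignedGraph.Vertex S → Sign) → Set
Balancing S θ = ∀ {u v} (e : Adj u v) → sign e ≡ θ u *ₛ θ v
  where open SignedGraph S

*ₛ-cancelˡ-square : ∀ s x y → (s *ₛ x) *ₛ (s *ₛ y) ≡ x *ₛ y
*ₛ-cancelˡ-square s x y = trans (interchange s x s y) (cong (_*ₛ (x *ₛ y)) (Sign.s*s≡+ s))

*ₛ-cancelʳ-square : ∀ s x y → (x *ₛ s) *ₛ (y *ₛ s) ≡ x *ₛ y
*ₛ-cancelʳ-square s x y = trans (interchange x s y s)
  (trans (cong ((x *ₛ y) *ₛ_) (Sign.s*s≡+ s)) (Sign.*-identityʳ (x *ₛ y)))

tailSignature : ∀ {r} → Signature (P (suc r)) → Signature (P r)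
tailSignature {r} σ = record
  { sign     = sign ∘ lift
  ; sign-sym = λ {i} {j} e →
      trans (cong sign (consecutive-irrelevant (lift (swap e)) (swap (lift e)))) (sign-sym (lift e))
  }
  where
  open Signature σ

  lift : ∀ {i j : Fin r} → Consecutive i j → Consecutive (suc i) (suc j)
  lift (inj₁ p) = inj₁ (cong suc p)
  lift (inj₂ p) = inj₂ (cong suc p)

-- The product of the edge signs from vertex 0 up to `i`, peeling off the first edge at each
-- recursive call.
switching : ∀ {r} → Signature (P r) → Fin r → Sign
switching               σ zero    = Sign.+
switching {suc (suc _)} σ (suc i) =
  Signature.sign σ {zero} {suc zero} (inj₁ refl) *ₛ switching (tailSignature σ) i

switching-forth : ∀ {r} (σ : Signature (P r)) {i j} (p : toℕ j ≡ suc (toℕ i)) →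
                  Signature.sign σ (inj₁ p) ≡ switching σ i *ₛ switching σ j
switching-forth {suc (suc _)} σ {zero} {suc zero} refl = sym (Sign.*-identityʳ _)
switching-forth {suc (suc _)} σ {suc i} {suc j} p = begin
  -- `tailSignature` evaluates `sign` at a lifted proof; irrelevance exchanges `p` for it. The sign
  -- `s` of the first edge then occurs in both factors and cancels.
  sign (inj₁ p)                             ≡⟨ cong sign (consecutive-irrelevant (inj₁ p) _) ⟩
  sign (inj₁ (cong suc (suc-injective p)))  ≡⟨ switching-forth τ (suc-injective p) ⟩
  switching τ i *ₛ switching τ j            ≡⟨ *ₛ-cancelˡ-square s _ _ ⟨
  (s *ₛ switching τ i) *ₛ (s *ₛ switching τ j) ∎
  where
  open ≡-Reasoning
  open Signature σ
  τ = tailSignature σ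
  s = sign {zero} {suc zero} (inj₁ refl)

switching-balancing : ∀ {r} (σ : Signature (P r)) → Balancing (P r , σ) (switching σ)
switching-balancing σ (inj₁ p) = switching-forth σ p
switching-balancing σ {u} {v} (inj₂ p) = begin
  sign (inj₂ p)                    ≡⟨ sign-sym (inj₂ p) ⟨
  sign (inj₁ p)                    ≡⟨ switching-forth σ p ⟩
  switching σ v *ₛ switching σ u   ≡⟨ Sign.*-comm (switching σ v) _ ⟩
  switching σ u *ₛ switching σ v   ∎
  where
  open ≡-Reasoning
  open Signature σ

-- Along one factor, the switching sign of the unchanged coordinate occurs twice and cancels; on a
-- diagonal edge the four signs regroup.
⊠-balancing : ∀ S₁ S₂ θ₁ θ₂ → Balancing S₁ θ₁ → Balancing S₂ θ₂ →
              Balancing (S₁ ⊠ S₂) (λ (u , u′) → θ₁ u *ₛ θ₂ u′)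
⊠-balancing S₁ S₂ θ₁ θ₂ b₁ b₂ {u , _} {_} (inj₁ (refl , e′)) =
  trans (b₂ e′) (sym (*ₛ-cancelˡ-square (θ₁ u) _ _))
⊠-balancing S₁ S₂ θ₁ θ₂ b₁ b₂ {u , u′} {v , _} (inj₂ (inj₁ (e , refl))) =
  trans (b₁ e) (sym (*ₛ-cancelʳ-square (θ₂ u′) (θ₁ u) (θ₁ v)))
⊠-balancing S₁ S₂ θ₁ θ₂ b₁ b₂ {u , _} {v , _} (inj₂ (inj₂ (e , e′))) =
  trans (cong₂ _*ₛ_ (b₁ e) (b₂ e′)) (interchange (θ₁ u) (θ₁ v) _ _)

record AntisymmetricColoring (G : Graph) (k : ℕ) : Set where
  open Graph G
  field
    value         : ∀ {u v} → Adj u v → ℤ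
    range         : ∀ {u v} (e : Adj u v) → value e ∈M k
    antisymmetric : ∀ {u v} (e : Adj u v) → value (adj-sym e) ≡ - value e
    injective     : ∀ {u v₁ v₂} (e₁ : Adj u v₁) (e₂ : Adj u v₂) →
                    value e₁ ≡ value e₂ → v₁ ≡ v₂

module _ {S : SignedGraph} {θ : SignedGraph.Vertex S → Sign} {k : ℕ}
         (balancing : Balancing S θ)
         (c : AntisymmetricColoring (SignedGraph.graph S) k) where
  open SignedGraph S
  open AntisymmetricColoring c

  unit : Vertex → ℤ
  unit u = θ u ◃ 1

  ∣unit*z∣≡∣z∣ : ∀ u z → ∣ unit u *ℤ z ∣ ≡ ∣ z ∣
  ∣unit*z∣≡∣z∣ u z = begin
    ∣ unit u *ℤ z ∣        ≡⟨ ℤ.abs-* (unit u) z ⟩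
    ∣ unit u ∣ * ∣ z ∣     ≡⟨ cong (_* ∣ z ∣) (ℤ.abs-◃ (θ u) 1) ⟩
    1 * ∣ z ∣              ≡⟨ *-identityˡ ∣ z ∣ ⟩
    ∣ z ∣                  ∎
    where open ≡-Reasoning

  -- Used with `s = θ u` and `t = θ v`; it amounts to `t * t = 1`. Fixing both signs leaves
  -- identities in `z` for the ring solver.
  switch-signed : ∀ s t z → (s ◃ 1) *ℤ z ≡ - ((s *ₛ t) ◃ 1) *ℤ ((t ◃ 1) *ℤ - z)
  switch-signed Sign.+ Sign.+ = solve-∀
  switch-signed Sign.+ Sign.- = solve-∀
  switch-signed Sign.- Sign.+ = solve-∀
  switch-signed Sign.- Sign.- = solve-∀

  -- Scaling all incidences at `u` by the unit of `θ u` keeps absolute values, hence M_k, and keeps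
  -- colors at `u` distinct.
  switchedColoring : EdgeColoring S k
  switchedColoring = record
    { color  = λ {u} e → unit u *ℤ value e
    ; range  = λ {u} e → ∈M-resp-∣∣ {unit u *ℤ value e} {value e} (∣unit*z∣≡∣z∣ u _) (range e)
    ; signed = signed
    ; proper = λ {u} e₁ e₂ v₁≢v₂ eq → v₁≢v₂ (injective e₁ e₂
        (ℤ.*-cancelˡ-≡ (unit u) _ _ {{ℤ.◃-nonZero (θ u) 1}} eq))
    }
    where
    signed : ∀ {u v} (e : Adj u v) →
             unit u *ℤ value e ≡ - (sign e ◃ 1) *ℤ (unit v *ℤ value (adj-sym e))
    signed {u} {v} e rewrite balancing e | antisymmetric e = switch-signed (θ u) (θ v) (value e)

-- Displacements

-- The step a moves by toℕ a - 1 along a path.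
Step : Set
Step = Fin 3

pattern back  = 0F
pattern stay  = 1F
pattern forth = 2F

-- The equation v = u + (a - 1), rearranged to avoid subtraction on naturals.
record _–[_]→_ {r : ℕ} (u : Fin r) (a : Step) (v : Fin r) : Set where
  constructor moves
  field
    position : toℕ u + toℕ a ≡ suc (toℕ v)

step : ∀ {r} {u v : Fin r} → Consecutive u v → Step
step (inj₁ _) = forth
step (inj₂ _) = back

step-moves : ∀ {r} {u v : Fin r} (e : Consecutive u v) → u –[ step e ]→ v
step-moves {u = u} (inj₁ p) = moves (trans (+-comm (toℕ u) 2) (cong suc (sym p)))
step-moves         (inj₂ p) = moves (trans (+-identityʳ _) p)

step-swap : ∀ {r} {u v : Fin r} (e : Consecutive u v) → step (swap e) ≡ opposite (step e)
step-swap (inj₁ _) = refl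
step-swap (inj₂ _) = refl

step≢stay : ∀ {r} {u v : Fin r} (e : Consecutive u v) → step e ≢ stay
step≢stay (inj₁ _) ()
step≢stay (inj₂ _) ()

stay-moves : ∀ {r} (u : Fin r) → u –[ stay ]→ u
stay-moves u = moves (+-comm (toℕ u) 1)

-- The maximum degree of P_r, and also the largest difference between two steps available at one
-- vertex.
width : ℕ → ℕ
width r = 2 ⊓ (r ∸ 1)

-- Necessary for two steps to start at a common vertex. In width 1 it separates `back` from `forth`,
-- which may therefore share a color.
Compatible : ℕ → Step → Step → Set
Compatible w a b = ∣ toℕ a - toℕ b ∣ ≤ w

-- The common start cancels, so the steps differ exactly as their end vertices do, by at most
-- `r ∸ 1`; the bound 2 comes from `Step` itself.
moves-compatible : ∀ {r} {u v v′ : Fin r} {a a′} →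
                   u –[ a ]→ v → u –[ a′ ]→ v′ → Compatible (width r) a a′
moves-compatible {r} {u} {v} {v′} {a} {a′} (moves p) (moves q) = ⊓-glb
  (≤-trans (∣m-n∣≤m⊔n (toℕ a) (toℕ a′)) (⊔-lub (toℕ≤pred[n] a) (toℕ≤pred[n] a′)))
  (begin
    ∣ toℕ a - toℕ a′ ∣                       ≡⟨ ∣m+n-m+o∣≡∣n-o∣ (toℕ u) _ _ ⟨
    ∣ toℕ u + toℕ a - toℕ u + toℕ a′ ∣       ≡⟨ cong₂ ∣_-_∣ p q ⟩
    ∣ toℕ v - toℕ v′ ∣                       ≤⟨ ∣m-n∣≤m⊔n (toℕ v) (toℕ v′) ⟩
    toℕ v ⊔ toℕ v′                           ≤⟨ ⊔-lub (toℕ≤pred[n] v) (toℕ≤pred[n] v′) ⟩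
    r ∸ 1                                    ∎)
  where open ≤-Reasoning

moves-functional : ∀ {r} {u v v′ : Fin r} {a a′} →
                   u –[ a ]→ v → u –[ a′ ]→ v′ → a ≡ a′ → v ≡ v′
moves-functional (moves p) (moves q) refl = toℕ-injective (suc-injective (trans (sym p) q))

-- Staying is possible at every vertex, so compatibility with `stay` bounds each coordinate; the
-- last clause excludes loops.
Admissible : ℕ → ℕ → Step → Step → Set
Admissible w₁ w₂ a b = Compatible w₁ a stay × Compatible w₂ b stay × ¬ (a ≡ stay × b ≡ stay)

-- A coloring of the product of two paths of widths w₁ and w₂ that depends only
-- on the displacement along an edge.
record Scheme (w₁ w₂ k : ℕ) : Set where
  field
    value         : Step → Step → ℤ
    antisymmetric : ∀ a b → value (opposite a) (opposite b) ≡ - value a b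
    range         : ∀ a b → Admissible w₁ w₂ a b → value a b ∈M k
    injective     : ∀ a b a′ b′ → Admissible w₁ w₂ a b → Admissible w₁ w₂ a′ b′ →
                    Compatible w₁ a a′ → Compatible w₂ b b′ →
                    value a b ≡ value a′ b′ → a ≡ a′ × b ≡ b′

-- From displacement schemes to colorings of the product

module _ (r s : ℕ) (σ₁ : Signature (P r)) (σ₂ : Signature (P s)) where
  private
    S₁ S₂ : SignedGraph
    S₁ = P r , σ₁
    S₂ = P s , σ₂

  open SignedGraph (S₁ ⊠ S₂) using (Adj; adj-sym; graph)

  steps : ∀ {x y} → Adj x y → Step × Step
  steps (inj₁ (_ , e′))        = stay , step e′
  steps (inj₂ (inj₁ (e , _)))  = step e , stay
  steps (inj₂ (inj₂ (e , e′))) = step e , step e′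

  steps-move₁ : ∀ {x y} (e : Adj x y) → proj₁ x –[ proj₁ (steps e) ]→ proj₁ y
  steps-move₁ {u , _} (inj₁ (refl , _)) = stay-moves u
  steps-move₁ (inj₂ (inj₁ (e , _)))     = step-moves e
  steps-move₁ (inj₂ (inj₂ (e , _)))     = step-moves e

  steps-move₂ : ∀ {x y} (e : Adj x y) → proj₂ x –[ proj₂ (steps e) ]→ proj₂ y
  steps-move₂ (inj₁ (_ , e′))                  = step-moves e′
  steps-move₂ {_ , u′} (inj₂ (inj₁ (_ , refl))) = stay-moves u′
  steps-move₂ (inj₂ (inj₂ (_ , e′)))           = step-moves e′

  steps-sym : ∀ {x y} (e : Adj x y) →
    steps (adj-sym e) ≡ (opposite (proj₁ (steps e)) , opposite (proj₂ (steps e)))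
  steps-sym (inj₁ (_ , e′))        = cong (stay ,_) (step-swap e′)
  steps-sym (inj₂ (inj₁ (e , _)))  = cong (_, stay) (step-swap e)
  steps-sym (inj₂ (inj₂ (e , e′))) = cong₂ _,_ (step-swap e) (step-swap e′)

  steps-nonzero : ∀ {x y} (e : Adj x y) → ¬ (proj₁ (steps e) ≡ stay × proj₂ (steps e) ≡ stay)
  steps-nonzero (inj₁ (_ , e′))       (_ , q) = step≢stay e′ q
  steps-nonzero (inj₂ (inj₁ (e , _))) (p , _) = step≢stay e p
  steps-nonzero (inj₂ (inj₂ (e , _))) (p , _) = step≢stay e p

  steps-admissible : ∀ {x y} (e : Adj x y) →
    Admissible (width r) (width s) (proj₁ (steps e)) (proj₂ (steps e))
  steps-admissible {u , u′} e =
    moves-compatible (steps-move₁ e) (stay-moves u) ,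
    moves-compatible (steps-move₂ e) (stay-moves u′) ,
    steps-nonzero e

  -- Two edges at one vertex have compatible steps in both coordinates, so `injective` applies;
  -- equal steps from that vertex then reach the same end.
  schemeColoring : ∀ {k} → Scheme (width r) (width s) k → AntisymmetricColoring graph k
  schemeColoring {k} scheme = record
    { value         = λ e → value (proj₁ (steps e)) (proj₂ (steps e))
    ; range         = λ e → range _ _ (steps-admissible e)
    ; antisymmetric = λ e → trans (cong (λ (a , b) → value a b) (steps-sym e)) (antisymmetric _ _)
    ; injective     = inj
    }
    where
    open Scheme scheme

    inj : ∀ {x y₁ y₂} (e₁ : Adj x y₁) (e₂ : Adj x y₂) →
          value (proj₁ (steps e₁)) (proj₂ (steps e₁)) ≡
          value (proj₁ (steps e₂)) (proj₂ (steps e₂)) → y₁ ≡ y₂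
    inj e₁ e₂ eq
      with injective _ _ _ _ (steps-admissible e₁) (steps-admissible e₂)
             (moves-compatible (steps-move₁ e₁) (steps-move₁ e₂))
             (moves-compatible (steps-move₂ e₁) (steps-move₂ e₂)) eq
    ... | p , q = cong₂ _,_ (moves-functional (steps-move₁ e₁) (steps-move₁ e₂) p)
                            (moves-functional (steps-move₂ e₁) (steps-move₂ e₂) q)

-- Colorings by displacement

compatible? : ∀ w a b → Dec (Compatible w a b)
compatible? w a b = ∣ toℕ a - toℕ b ∣ ≤? w

admissible? : ∀ w₁ w₂ a b → Dec (Admissible w₁ w₂ a b)
admissible? w₁ w₂ a b = compatible? w₁ a stay ×-dec compatible? w₂ b stay
                        ×-dec ¬? (a Fin.≟ stay ×-dec b Fin.≟ stay)

-- `_∈M_` quantifies existentially over `l`; fixing `l` gives a test that evaluates.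
record DecidableSubset (k : ℕ) : Set₁ where
  field
    Member  : ℤ → Set
    member? : ∀ z → Dec (Member z)
    ⊆M      : ∀ {z} → Member z → z ∈M k

oddPalette : ∀ l → DecidableSubset (2 * l + 1)
oddPalette l = record
  { member? = λ z → ∣ z ∣ ≤? l
  ; ⊆M      = λ ∣z∣≤l → l , inj₁ (refl , ∣z∣≤l)
  }

evenPalette : ∀ l → DecidableSubset (2 * l)
evenPalette l = record
  { member? = λ z → 1 ≤? ∣ z ∣ ×-dec ∣ z ∣ ≤? l
  ; ⊆M      = λ bounds → l , inj₂ (refl , bounds)
  }

-- All three conditions range over the finite type `Step`, so for a concrete `c` the implicit
-- arguments are discharged by evaluation.
scheme-by-enumeration :
  ∀ w₁ w₂ {k} (M : DecidableSubset k) (c : Step → Step → ℤ) →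
  {_ : True (all? λ a → all? λ b → c (opposite a) (opposite b) ℤ.≟ - c a b)}
  {_ : True (all? λ a → all? λ b → admissible? w₁ w₂ a b →-dec DecidableSubset.member? M (c a b))}
  {_ : True (all? λ a → all? λ b → all? λ a′ → all? λ b′ →
         admissible? w₁ w₂ a b →-dec admissible? w₁ w₂ a′ b′ →-dec
         compatible? w₁ a a′ →-dec compatible? w₂ b b′ →-dec
         c a b ℤ.≟ c a′ b′ →-dec (a Fin.≟ a′ ×-dec b Fin.≟ b′))} →
  Scheme w₁ w₂ k
scheme-by-enumeration w₁ w₂ M c {p} {q} {t} = record
  { value         = c
  ; antisymmetric = toWitness p
  ; range         = λ a b adm → DecidableSubset.⊆M M (toWitness q a b adm)
  ; injective     = toWitness t
  }

transposeScheme : ∀ {w₁ w₂ k} → Scheme w₁ w₂ k → Scheme w₂ w₁ k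
transposeScheme scheme = record
  { value         = λ a b → value b a
  ; antisymmetric = λ a b → antisymmetric b a
  ; range         = λ a b adm → range b a (flip adm)
  ; injective     = λ a b a′ b′ adm adm′ p q eq →
      Product.swap (injective b a b′ a′ (flip adm) (flip adm′) q p eq)
  }
  where
  open Scheme scheme

  flip : ∀ {w₁ w₂ a b} → Admissible w₁ w₂ a b → Admissible w₂ w₁ b a
  flip (p , q , n) = q , p , n ∘ Product.swap

-- Explicit schemes for each pair of widths

offset : Step → ℤ
offset a = toℕ a ⊖ 1

-- The product is a single edge, and 0 is its own negative.
scheme₀₁ : Scheme 0 1 1
scheme₀₁ = scheme-by-enumeration 0 1 (oddPalette 0) (λ _ _ → 0ℤ)

scheme₀₂ : Scheme 0 2 2
scheme₀₂ = scheme-by-enumeration 0 2 (evenPalette 1) (λ _ b → offset b)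

-- Here the product is K₄: one perfect matching gets color 0, and the remaining
-- 4-cycle is oriented cyclically with colors ±1.
scheme₁₁ : Scheme 1 1 3
scheme₁₁ = scheme-by-enumeration 1 1 (oddPalette 1)
  (λ a b → offset b *ℤ (+ 1 -ℤ + 2 *ℤ + ∣ offset a ∣))

-- Color 0 goes to the edges along the two-vertex path, ±1 to those along the longer path, ±2 to the
-- diagonals.
scheme₁₂ : Scheme 1 2 5
scheme₁₂ = scheme-by-enumeration 1 2 (oddPalette 2) (λ a b → offset b *ℤ (+ 1 +ℤ + ∣ offset a ∣))

-- Balanced ternary with two digits.
scheme₂₂ : Scheme 2 2 8
scheme₂₂ = scheme-by-enumeration 2 2 (evenPalette 4) (λ a b → offset a +ℤ + 3 *ℤ offset b)

-- (w₁ + 1)(w₂ + 1) - 1, the maximum degree for widths w₁ and w₂.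
maxSteps : ℕ → ℕ → ℕ
maxSteps w₁ w₂ = w₂ + w₁ * suc w₂

scheme : ∀ r s → r ≥ 1 → s ≥ 1 → r > 1 ⊎ s > 1 →
         Scheme (width r) (width s) (maxSteps (width r) (width s))
scheme 1 1 _ _ (inj₁ (s≤s ()))
scheme 1 1 _ _ (inj₂ (s≤s ()))
scheme 1                   2                   _ _ _ = scheme₀₁
scheme 1                   (suc (suc (suc _))) _ _ _ = scheme₀₂
scheme 2                   1                   _ _ _ = transposeScheme scheme₀₁
scheme 2                   2                   _ _ _ = scheme₁₁
scheme 2                   (suc (suc (suc _))) _ _ _ = scheme₁₂
scheme (suc (suc (suc _))) 1                   _ _ _ = transposeScheme scheme₀₂
scheme (suc (suc (suc _))) 2                   _ _ _ = transposeScheme scheme₁₂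
scheme (suc (suc (suc _))) (suc (suc (suc _))) _ _ _ = scheme₂₂

1≤maxSteps : ∀ r s → r ≥ 1 → s ≥ 1 → r > 1 ⊎ s > 1 → 1 ≤ maxSteps (width r) (width s)
1≤maxSteps 1             1             _ _ (inj₁ (s≤s ()))
1≤maxSteps 1             1             _ _ (inj₂ (s≤s ()))
1≤maxSteps _             (suc (suc _)) _ _ _ = s≤s z≤n
1≤maxSteps (suc (suc _)) 1             _ _ _ = s≤s z≤n

-- Vertices of maximum degree

record ClosedNeighbourhood (r : ℕ) (size : ℕ) : Set where
  field
    centre : Fin r
    nodes  : List (Fin r)
    unique : Unique nodes
    near   : All (λ v → centre ≡ v ⊎ Consecutive centre v) nodes
    size-≡ : length nodes ≡ size

-- From three vertices on, vertex 1 is inner and has both neighbours; on shorter paths an endpoint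
-- already has maximum degree.
closedNeighbourhood : ∀ r → r ≥ 1 → ClosedNeighbourhood r (suc (width r))
closedNeighbourhood 1 _ = record
  { centre = zero
  ; nodes  = zero ∷ []
  ; unique = [] ∷ []
  ; near   = inj₁ refl ∷ []
  ; size-≡ = refl
  }
closedNeighbourhood 2 _ = record
  { centre = zero
  ; nodes  = zero ∷ suc zero ∷ []
  ; unique = ((λ ()) ∷ []) ∷ [] ∷ []
  ; near   = inj₁ refl ∷ inj₂ (inj₁ refl) ∷ []
  ; size-≡ = refl
  }
closedNeighbourhood (suc (suc (suc _))) _ = record
  { centre = suc zero
  ; nodes  = zero ∷ suc zero ∷ suc (suc zero) ∷ []
  ; unique = ((λ ()) ∷ (λ ()) ∷ []) ∷ ((λ ()) ∷ []) ∷ [] ∷ []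
  ; near   = inj₂ (inj₂ refl) ∷ inj₁ refl ∷ inj₂ (inj₁ refl) ∷ []
  ; size-≡ = refl
  }

length-cartesianProduct : ∀ {A B : Set} (xs : List A) (ys : List B) →
                          length (cartesianProduct xs ys) ≡ length xs * length ys
length-cartesianProduct []       ys = refl
length-cartesianProduct (x ∷ xs) ys = trans (length-++ (map (x ,_) ys))
  (cong₂ _+_ (length-map (x ,_) ys) (length-cartesianProduct xs ys))

module _ {r s m n : ℕ} (σ₁ : Signature (P r)) (σ₂ : Signature (P s))
         (N₁ : ClosedNeighbourhood r m) (N₂ : ClosedNeighbourhood s n) where
  private
    module N₁ = ClosedNeighbourhood N₁
    module N₂ = ClosedNeighbourhood N₂

  open SignedGraph ((P r , σ₁) ⊠ (P s , σ₂)) using (Adj; graph; degree)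

  m*n≤1+degree : m * n ≤ suc (degree (N₁.centre , N₂.centre))
  m*n≤1+degree = subst (_≤ suc (degree (N₁.centre , N₂.centre)))
    (trans (length-cartesianProduct N₁.nodes N₂.nodes) (cong₂ _*_ N₁.size-≡ N₂.size-≡))
    (closedNeighbours≤1+degree graph _ (Unique.cartesianProduct⁺ N₁.unique N₂.unique)
      (All.tabulate near⊠))
    where
    near⊠ : ∀ {y} → y ∈ cartesianProduct N₁.nodes N₂.nodes →
            (N₁.centre , N₂.centre) ≡ y ⊎ Adj (N₁.centre , N₂.centre) y
    near⊠ y∈ with ∈-cartesianProduct⁻ N₁.nodes N₂.nodes y∈
    ... | v∈ , v′∈ with All.lookup N₁.near v∈ | All.lookup N₂.near v′∈
    ... | inj₁ p | inj₁ q = inj₁ (cong₂ _,_ p q)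
    ... | inj₁ p | inj₂ f = inj₂ (inj₁ (p , f))
    ... | inj₂ e | inj₁ q = inj₂ (inj₂ (inj₁ (e , q)))
    ... | inj₂ e | inj₂ f = inj₂ (inj₂ (inj₂ (e , f)))

theorem23 : (r s : ℕ) → r ≥ 1 → s ≥ 1 →
    (σ₁ : Signature (P r)) (σ₂ : Signature (P s)) →
    r > 1 ⊎ s > 1 →
    let S = (P r , σ₁) ⊠ (P s , σ₂) in
    IsChromaticIndex S (Δ S)
theorem23 r s r≥1 s≥1 σ₁ σ₂ r>1⊎s>1 =
  isChromaticIndex-Δ ((P r , σ₁) ⊠ (P s , σ₂)) _ (1≤maxSteps r s r≥1 s≥1 r>1⊎s>1)
    -- The product `suc w₁ * suc w₂` unfolds to `suc (maxSteps w₁ w₂)`; the removed successor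
    -- accounts for the centre itself.
    (s≤s⁻¹ (m*n≤1+degree σ₁ σ₂ (closedNeighbourhood r r≥1) (closedNeighbourhood s s≥1)))
    (switchedColoring {θ = λ (u , u′) → switching σ₁ u *ₛ switching σ₂ u′}
      (λ {x} {y} → ⊠-balancing (P r , σ₁) (P s , σ₂) (switching σ₁) (switching σ₂)
        (switching-balancing σ₁) (switching-balancing σ₂) {x} {y})
      (schemeColoring r s σ₁ σ₂ (scheme r s r≥1 s≥1 r>1⊎s>1)))
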